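{- Let $n,\lambda,m,t$ be positive integers with $m=t+1$ and $m\le\lambda\le \frac{n(n-1)}{2}$. If $\mu(\lambda,m;t)\ge n-1$ and $2\lambda\ge (t+1)n$, then there exists a $(t+1)$-color connected colored edge graph $G(V,E,C,f)$ with $|V|=n$, $|E|=\lambda$ and $|C|=m$.
   Context: All graphs are finite, undirected and simple (no loops, no multiple edges). A colored edge graph is a tuple $G(V,E,C,f)$ where $(V,E)$ is a graph with node set $V$ and edge set $E$, $C$ is a finite set of colors, and $f:E\to C$ is a surjective map. For an integer $t\ge 1$, two distinct nodes $A,B\in V$ are $(t+1)$-color connected if for every color set $C_t\subseteq C$ with $|C_t|=t$ there is a path from $A$ to $B$ in $G$ none of whose edges has a color in $C_t$. The colored edge graph $G$ is $(t+1)$-color connected if every two distinct nodes of $G$ are $(t+1)$-color connected. A $(\lambda,m)$-partition is a pair $(X,\mathcal{F})$ where $X$ is a finite set with $|X|=\lambda$ and $\mathcal{F}$ is a set of mutually disjoint subsets of $X$ with $|\mathcal{F}|=m$ and $X=\bigcup_{P\in\mathcal{F}}P$. For $1\le t\le m$ put $\mu(X,\mathcal{F};t)=\min\{|X\setminus(B_1\cup\cdots\cup B_t)| : B_1,\ldots,B_t \text{ distinct elements of } \mathcal{F}\}$, and $\mu(\lambda,m;t)=\max\{\mu(X,\mathcal{F};t): (X,\mathcal{F})\text{ is a }(\lambda,m)\text{ -partition}\}$. -}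

module Defs where

open import Data.Nat using (ℕ; _+_; _≤_)
open import Data.Fin using (Fin; _<_)
open import Data.Fin.Subset using (Subset; ⊤; ∁; ⋃; _∩_; ∣_∣; Empty; _∉_)
open import Data.List using (List; []; _∷_; length)
open import Data.List.Membership.Propositional using (_∈_)
open import Data.List.Relation.Unary.All using (All)
open import Data.List.Relation.Unary.AllPairs using (AllPairs)
open import Data.List.Relation.Unary.Unique.Propositional using (Unique)
open import Data.Product using (_×_; _,_; ∃; ∃-syntax; proj₁; proj₂)
open import Data.Sum using (_⊎_)
open import Function.Definitions using (Surjective)
open import Relation.Binary.PropositionalEquality using (_≡_; _≢_)

IsMinimum IsMaximum : (ℕ → Set) → ℕ → Set
IsMinimum P k = P k × (∀ j → P j → k ≤ j)
IsMaximum P k = P k × (∀ j → P j → j ≤ k)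

-- Nodes are Fin n and colors are Fin m, so |V| = n and |C| = m.  The undirected
-- edge {i , j} is stored once, as the pair (i , j) with i < j; this excludes
-- loops, and Unique excludes multiple edges, so |E| is the length of the list.
-- Unique also makes membership proofs unique, so color is a map on edges.
record ColoredEdgeGraph (n m : ℕ) : Set where
  field
    edges    : List (Fin n × Fin n)
    oriented : All (λ e → proj₁ e < proj₂ e) edges
    unique   : Unique edges

  Edge : Set
  Edge = ∃[ e ] e ∈ edges

  field
    color            : Edge → Fin m
    color-surjective : Surjective _≡_ _≡_ color

  ∣E∣ : ℕ
  ∣E∣ = length edges

  Joins : Edge → Fin n → Fin n → Set
  Joins (e , _) A B = e ≡ (A , B) ⊎ e ≡ (B , A)

  data Walk : Fin n → Fin n → Set where
    nil  : ∀ {A} → Walk A A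
    cons : ∀ {A B D} (e : Edge) → Joins e A B → Walk B D → Walk A D

  nodesOf : ∀ {A B} → Walk A B → List (Fin n)
  nodesOf {A} nil          = A ∷ []
  nodesOf {A} (cons _ _ w) = A ∷ nodesOf w

  edgesOf : ∀ {A B} → Walk A B → List Edge
  edgesOf nil          = []
  edgesOf (cons e _ w) = e ∷ edgesOf w

  IsPath : ∀ {A B} → Walk A B → Set
  IsPath w = Unique (nodesOf w)

  Avoids : ∀ {A B} → Subset m → Walk A B → Set
  Avoids S w = All (λ e → color e ∉ S) (edgesOf w)

  -- The parameter is t + 1, where t is the size of the removed color sets.
  NodesColorConnected : ℕ → Fin n → Fin n → Set
  NodesColorConnected k A B =
    ∀ (S : Subset m) → ∣ S ∣ + 1 ≡ k → ∃[ w ] IsPath {A} {B} w × Avoids S w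

  ColorConnected : ℕ → Set
  ColorConnected k = ∀ A B → A ≢ B → NodesColorConnected k A B

-- The underlying set X is Fin l, and the set 𝓕 of subsets is a list without
-- repetitions.  The empty set may be a member of 𝓕.
record IsPartition (l m : ℕ) (𝓕 : List (Subset l)) : Set where
  field
    distinct : Unique 𝓕
    size     : length 𝓕 ≡ m
    disjoint : AllPairs (λ P Q → Empty (P ∩ Q)) 𝓕
    covers   : ⋃ 𝓕 ≡ ⊤

Remainder : ∀ {l} → List (Subset l) → ℕ → ℕ → Set
Remainder 𝓕 t r =
  ∃[ Bs ] Unique Bs × length Bs ≡ t × All (_∈ 𝓕) Bs × r ≡ ∣ ∁ (⋃ Bs) ∣

-- k = μ(X, 𝓕; t)
IsPartitionμ : ∀ {l} → List (Subset l) → ℕ → ℕ → Set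
IsPartitionμ 𝓕 t = IsMinimum (Remainder 𝓕 t)

-- Isμ l m t k says k = μ(l, m; t).  Such a k is unique, and it exists whenever
-- 1 ≤ t ≤ m ≤ l.
Isμ : ℕ → ℕ → ℕ → ℕ → Set
Isμ l m t = IsMaximum (λ r → ∃[ 𝓕 ] IsPartition l m 𝓕 × IsPartitionμ 𝓕 t r)

{-# OPTIONS --safe #-}
-- When t of the t + 1 colors are removed, a single color survives, so every
-- color class has to be a connected spanning subgraph.  The bound on μ, read on
-- the complements of the members of a partition, gives m (n - 1) ≤ l; together
-- with l ≤ n (n - 1) / 2 this yields 2 m ≤ n, and then K_n contains m edge-disjoint
-- spanning trees.  The tree of color c is a double star with adjacent hubs c and
-- m + c: a node w is joined to m + c if w < c, to c if c < w ≤ m + c, and to m + c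
-- if m + c < w.  The edges that remain to be chosen are arbitrary.
module Submission where

open import Data.Nat using (ℕ; zero; suc; _+_; _*_; _∸_; _/_; _≤_; _≥_; _<_; _⊔_; _⊓_; z≤n; s≤s; _<?_; _≤?_)
open import Data.Nat.Properties
open import Data.Nat.DivMod using (_%_; _mod_; m<n⇒m%n≡m; m/n*n≤m)
open import Data.Fin as Fin using (Fin; toℕ; _↑ˡ_; _↑ʳ_; inject≤; punchIn; punchOut)
import Data.Fin.Properties as Fin
open import Data.Fin.Subset as Subset using (Subset; inside; outside; ∁; ⋃; _∩_; _∪_; ∣_∣; Empty)
open import Data.Fin.Subset.Properties using (_∈?_; ∉⊥; ∈⊤; ∣p∣≤n; p⊆q⇒∣p∣≤∣q∣; x∈∁p⇒x∉p; x∈p∩q⁺; x∈p∩q⁻; x∈p∪q⁺; x∈p∪q⁻; ⊆⊤; ⊆-antisym; ∣⊤∣≡n; drop-∷-Empty)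
open import Data.List using (List; []; _∷_; _++_; length; map; filter; take; deduplicate; allFin; cartesianProductWith)
open import Data.List.Properties using (length-++; length-map; length-take; length-tabulate; length-deduplicate)
open import Data.List.Membership.Propositional using (_∈_)
open import Data.List.Membership.Propositional.Properties using (∈-++⁺ˡ; ∈-++⁺ʳ; ∈-filter⁺; ∈-map⁻; ∈-deduplicate⁺; ∈-allFin; ∈-∃++; ∈-cartesianProductWith⁺)
import Data.List.Membership.DecPropositional as DecMembership
open import Data.List.Relation.Unary.All as All using (All; []; _∷_)
import Data.List.Relation.Unary.All.Properties as All
open import Data.List.Relation.Unary.Any using (here; there)
open import Data.List.Relation.Unary.AllPairs using (AllPairs; []; _∷_)
open import Data.List.Relation.Unary.Unique.Propositional using (Unique)
open import Data.List.Relation.Unary.Unique.Propositional.Properties as Unique using (Unique[x∷xs]⇒x∉xs)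
import Data.List.Relation.Unary.Unique.DecPropositional.Properties as DecUnique
open import Data.List.Relation.Binary.Subset.Propositional using (_⊆_)
open import Data.List.Relation.Binary.Permutation.Propositional using (_↭_; ↭-sym; ↭⇒↭ₛ)
open import Data.List.Relation.Binary.Permutation.Propositional.Properties using (shift; ↭-length; ∈-resp-↭)
import Data.List.Relation.Binary.Permutation.Setoid.Properties as ↭ₛ
open import Data.Product using (_×_; _,_; ∃-syntax; Σ-syntax; proj₁; proj₂)
import Data.Product.Properties as Product
open import Data.Sum using (_⊎_; inj₁; inj₂)
open import Data.Vec using ([]; _∷_; here)
open import Function using (_∘_)
open import Relation.Binary.Construct.Closure.Equivalence as EqClosure using (EqClosure)
open import Relation.Binary.Construct.Closure.ReflexiveTransitive using (ε; _◅_)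
open import Relation.Binary.Construct.Closure.Symmetric using (fwd; bwd)
open import Relation.Binary.Definitions using (DecidableEquality; tri<; tri≈; tri>)
open import Relation.Binary.PropositionalEquality using (_≡_; _≢_; refl; sym; trans; cong; cong₂; subst; subst₂; setoid; module ≡-Reasoning)
open import Relation.Nullary using (¬_; yes; no; contradiction; ¬?)
open import Defs

-- Lists without repetitions

module _ {A : Set} where

  split-∈ : ∀ {x : A} {xs} → x ∈ xs → ∃[ ys ] xs ↭ x ∷ ys
  split-∈ {x} x∈xs with ys , zs , refl ← ∈-∃++ x∈xs = ys ++ zs , shift x ys zs

  -- Pigeonhole by induction: one occurrence of the head `x` is taken out of `ys`, and the tail of
  -- `xs` still fits into the rest because `x` does not recur in it.
  unique-⊆⇒length≤ : ∀ {xs ys : List A} → Unique xs → xs ⊆ ys → length xs ≤ length ys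
  unique-⊆⇒length≤ {[]}     _            _     = z≤n
  unique-⊆⇒length≤ {x ∷ xs} u@(_ ∷ uxs) xs⊆ys with zs , ys↭ ← split-∈ (xs⊆ys (here refl)) =
    subst (_ ≤_) (sym (↭-length ys↭)) (s≤s (unique-⊆⇒length≤ uxs xs⊆zs))
    where
    xs⊆zs : xs ⊆ zs
    xs⊆zs y∈xs with ∈-resp-↭ ys↭ (xs⊆ys (there y∈xs))
    ... | here refl  = contradiction y∈xs (Unique[x∷xs]⇒x∉xs u)
    ... | there y∈zs = y∈zs

  module _ (_≟_ : DecidableEquality A) where
    open DecMembership _≟_ using () renaming (_∈?_ to _∈ᴸ?_)

    -- Completes the tree edges to an edge list of prescribed length. `xs` is deduplicated and then
    -- topped up with entries of `ys` not yet present, so the tree edges can be passed in with their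
    -- number as a mere upper bound.
    extend-unique : ∀ {P : A → Set} (xs : List A) {ys k} → All P xs → All P ys → Unique ys →
      length xs ≤ k → k ≤ length ys →
      ∃[ zs ] All P zs × Unique zs × xs ⊆ zs × length zs ≡ k
    extend-unique xs {ys} {k} Pxs Pys uys xs≤k k≤ys =
        xs′ ++ take r new
      , All.++⁺ (All.deduplicate⁺ _≟_ Pxs) (All.take⁺ r (All.filter⁺ _ Pys))
      , Unique.++⁺ uxs′ (Unique.take⁺ r (Unique.filter⁺ _ uys)) disjoint
      , ∈-++⁺ˡ ∘ ∈-deduplicate⁺ _≟_
      , (begin-equality
          length (xs′ ++ take r new)       ≡⟨ length-++ xs′ ⟩
          length xs′ + length (take r new) ≡⟨ cong (length xs′ +_) (length-take r new) ⟩
          length xs′ + r ⊓ length new      ≡⟨ cong (length xs′ +_) (m≤n⇒m⊓n≡m r≤new) ⟩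
          length xs′ + r                   ≡⟨ m+[n∸m]≡n xs′≤k ⟩
          k                                ∎)
      where
      open ≤-Reasoning
      xs′ new : List A
      xs′ = deduplicate _≟_ xs
      new = filter (λ y → ¬? (y ∈ᴸ? xs′)) ys
      r : ℕ
      r = k ∸ length xs′
      uxs′ : Unique xs′
      uxs′ = DecUnique.deduplicate-! _≟_ xs
      xs′≤k : length xs′ ≤ k
      xs′≤k = ≤-trans (length-deduplicate _≟_ xs) xs≤k
      ys⊆ : ys ⊆ xs′ ++ new
      ys⊆ {y} y∈ys with y ∈ᴸ? xs′
      ... | yes y∈xs′ = ∈-++⁺ˡ y∈xs′
      ... | no  y∉xs′ = ∈-++⁺ʳ xs′ (∈-filter⁺ _ y∈ys y∉xs′)
      r≤new : r ≤ length new
      -- There are enough new entries: the `ys`, at least `k` in number and all distinct, lie in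
      -- `xs′ ++ new`.
      r≤new = m≤n+o⇒m∸n≤o k (length xs′) (begin
        k                       ≤⟨ k≤ys ⟩
        length ys               ≤⟨ unique-⊆⇒length≤ uys ys⊆ ⟩
        length (xs′ ++ new)     ≡⟨ length-++ xs′ ⟩
        length xs′ + length new ∎)
      disjoint : ∀ {y} → ¬ (y ∈ xs′ × y ∈ take r new)
      disjoint (y∈xs′ , y∈new) =
        All.lookup (All.take⁺ r (All.all-filter (λ y → ¬? (y ∈ᴸ? xs′)) ys)) y∈new y∈xs′

length-cartesianProductWith : ∀ {A B C : Set} (f : A → B → C) xs ys →
  length (cartesianProductWith f xs ys) ≡ length xs * length ys
length-cartesianProductWith f []       ys = refl
length-cartesianProductWith f (x ∷ xs) ys = trans (length-++ (map (f x) ys))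
  (cong₂ _+_ (length-map (f x) ys) (length-cartesianProductWith f xs ys))

length-allFin : ∀ n → length (allFin n) ≡ n
length-allFin n = length-tabulate {n = n} (λ i → i)

Unique-resp-↭ : ∀ {A : Set} {xs ys : List A} → xs ↭ ys → Unique xs → Unique ys
Unique-resp-↭ p = ↭ₛ.Unique-resp-↭ (setoid _) (↭⇒↭ₛ p)

-- Partitions

∈-⋃⁺ : ∀ {l} {x : Fin l} {P} {Ps : List (Subset l)} → P ∈ Ps → x Subset.∈ P → x Subset.∈ ⋃ Ps
∈-⋃⁺ (here refl)  x∈P = x∈p∪q⁺ (inj₁ x∈P)
∈-⋃⁺ (there P∈Ps) x∈P = x∈p∪q⁺ (inj₂ (∈-⋃⁺ P∈Ps x∈P))

∈-⋃⁻ : ∀ {l} {x : Fin l} (Ps : List (Subset l)) → x Subset.∈ ⋃ Ps → ∃[ P ] P ∈ Ps × x Subset.∈ P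
∈-⋃⁻ []       x∈ = contradiction x∈ ∉⊥
∈-⋃⁻ (P ∷ Ps) x∈ with x∈p∪q⁻ P (⋃ Ps) x∈
... | inj₁ x∈P = P , here refl , x∈P
... | inj₂ x∈⋃ with Q , Q∈ , x∈Q ← ∈-⋃⁻ Ps x∈⋃ = Q , there Q∈ , x∈Q

disjoint⇒∣p∣+∣q∣≤∣p∪q∣ : ∀ {l} (P Q : Subset l) → Empty (P ∩ Q) → ∣ P ∣ + ∣ Q ∣ ≤ ∣ P ∪ Q ∣
disjoint⇒∣p∣+∣q∣≤∣p∪q∣ []            []            _ = z≤n
disjoint⇒∣p∣+∣q∣≤∣p∪q∣ (inside  ∷ P) (inside  ∷ Q) e = contradiction (Fin.zero , here) e
disjoint⇒∣p∣+∣q∣≤∣p∪q∣ (inside  ∷ P) (outside ∷ Q) e =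
  s≤s (disjoint⇒∣p∣+∣q∣≤∣p∪q∣ P Q (drop-∷-Empty e))
disjoint⇒∣p∣+∣q∣≤∣p∪q∣ (outside ∷ P) (inside  ∷ Q) e =
  subst (_≤ suc ∣ P ∪ Q ∣) (sym (+-suc ∣ P ∣ ∣ Q ∣)) (s≤s (disjoint⇒∣p∣+∣q∣≤∣p∪q∣ P Q (drop-∷-Empty e)))
disjoint⇒∣p∣+∣q∣≤∣p∪q∣ (outside ∷ P) (outside ∷ Q) e =
  disjoint⇒∣p∣+∣q∣≤∣p∪q∣ P Q (drop-∷-Empty e)

disjoint⇒length*k≤∣⋃∣ : ∀ {l k} {Ps : List (Subset l)} → All (λ P → k ≤ ∣ P ∣) Ps →
  AllPairs (λ P Q → Empty (P ∩ Q)) Ps → length Ps * k ≤ ∣ ⋃ Ps ∣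
disjoint⇒length*k≤∣⋃∣ []         []         = z≤n
disjoint⇒length*k≤∣⋃∣ {Ps = P ∷ Ps} (k≤ ∷ ks) (dP ∷ ds) =
  ≤-trans (+-mono-≤ k≤ (disjoint⇒length*k≤∣⋃∣ ks ds)) (disjoint⇒∣p∣+∣q∣≤∣p∪q∣ P (⋃ Ps) empty)
  where
  empty : Empty (P ∩ ⋃ Ps)
  empty (x , x∈) with x∈P , x∈⋃ ← x∈p∩q⁻ P (⋃ Ps) x∈ with Q , Q∈ , x∈Q ← ∈-⋃⁻ Ps x∈⋃ =
    All.lookup dP Q∈ (x , x∈p∩q⁺ (x∈P , x∈Q))

-- Leaving one member `P` out of the `t + 1` gives an admissible choice of `t` members, whose union
-- misses at least `μ` points. All of these lie in `P`, so every member has at least `k` points, and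
-- the sizes of disjoint members add up.
partitionμ⇒m*k≤l : ∀ {l t μ k} {𝓕 : List (Subset l)} → IsPartition l (suc t) 𝓕 →
  IsPartitionμ 𝓕 t μ → k ≤ μ → suc t * k ≤ l
partitionμ⇒m*k≤l {l} {t} {μ} {k} {𝓕} part (_ , μ-min) k≤μ =
  subst (λ s → s * k ≤ l) size
    (≤-trans (disjoint⇒length*k≤∣⋃∣ (All.tabulate k≤∣P∣) disjoint) (∣p∣≤n (⋃ 𝓕)))
  where
  open IsPartition part
  k≤∣P∣ : ∀ {P} → P ∈ 𝓕 → k ≤ ∣ P ∣
  k≤∣P∣ {P} P∈𝓕 with Bs , 𝓕↭ ← split-∈ P∈𝓕 with _ ∷ uBs ← Unique-resp-↭ 𝓕↭ distinct =
    ≤-trans k≤μ (≤-trans (μ-min _ remainder) (p⊆q⇒∣p∣≤∣q∣ ∁⋃Bs⊆P))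
    where
    remainder : Remainder 𝓕 t ∣ ∁ (⋃ Bs) ∣
    remainder = Bs , uBs , suc-injective (trans (sym (↭-length 𝓕↭)) size)
              , All.tabulate (λ B∈ → ∈-resp-↭ (↭-sym 𝓕↭) (there B∈)) , refl
    ∁⋃Bs⊆P : ∁ (⋃ Bs) Subset.⊆ P
    -- Some member contains `x`, and it is none of the `Bs`.
    ∁⋃Bs⊆P {x} x∈ with ∈-⋃⁻ 𝓕 (subst (x Subset.∈_) (sym covers) ∈⊤)
    ... | Q , Q∈𝓕 , x∈Q with ∈-resp-↭ 𝓕↭ Q∈𝓕
    ...   | here refl = x∈Q
    ...   | there Q∈Bs = contradiction (∈-⋃⁺ Q∈Bs x∈Q) (x∈∁p⇒x∉p x∈)

∃∉ : ∀ {m} (S : Subset m) → ∣ S ∣ < m → ∃[ c ] c Subset.∉ S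
∃∉ {m} S ∣S∣<m = Fin.¬∀⟶∃¬ m (Subset._∈ S) (_∈? S) λ all →
  <⇒≢ ∣S∣<m (trans (cong ∣_∣ (⊆-antisym ⊆⊤ (λ {x} _ → all x))) (∣⊤∣≡n m))

-- Walks and paths

module _ {n m} (G : ColoredEdgeGraph n m) (S : Subset m) where
  open ColoredEdgeGraph G
  open DecMembership (Fin._≟_ {n}) using () renaming (_∈?_ to _∈ᴸ?_)

  SafePath : Fin n → Fin n → Set
  SafePath A B = ∃[ w ] IsPath {A} {B} w × Avoids S w

  -- Lets `consPath` avoid a repeated node: if the new starting node already lies on the path, the
  -- loop before it is cut off instead of adding the edge.
  suffixFrom : ∀ {A B D} (w : Walk B D) → IsPath w → Avoids S w → A ∈ nodesOf w → SafePath A D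
  suffixFrom nil          p       a       (here refl) = nil , p , a
  suffixFrom (cons e j w) p       a       (here refl) = cons e j w , p , a
  suffixFrom (cons e j w) (_ ∷ p) (_ ∷ a) (there A∈)  = suffixFrom w p a A∈

  -- Surviving edges in their stored orientation. Symmetry and transitivity are left to `EqClosure`,
  -- so connectivity arguments need not handle paths.
  _∼_ : Fin n → Fin n → Set
  A ∼ B = ∃[ e ] proj₁ e ≡ (A , B) × color e Subset.∉ S

  consPath : ∀ {A B D} e → Joins e A B → color e Subset.∉ S → SafePath B D → SafePath A D
  consPath {A} e j e∉S (w , p , a) with A ∈ᴸ? nodesOf w
  ... | yes A∈ = suffixFrom w p a A∈
  ... | no  A∉ = cons e j w , All.¬Any⇒All¬ _ A∉ ∷ p , e∉S ∷ a

  connected⇒path : ∀ {A B} → EqClosure _∼_ A B → SafePath A B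
  connected⇒path ε                          = nil , [] ∷ [] , []
  connected⇒path (fwd (e , e≡ , e∉S) ◅ A∼B) = consPath e (inj₁ e≡) e∉S (connected⇒path A∼B)
  connected⇒path (bwd (e , e≡ , e∉S) ◅ A∼B) = consPath e (inj₂ e≡) e∉S (connected⇒path A∼B)

-- The edges of the complete graph

Oriented : ∀ {n} → Fin n × Fin n → Set
Oriented e = proj₁ e Fin.< proj₂ e

suc² : ∀ {n} → Fin n × Fin n → Fin (suc n) × Fin (suc n)
suc² (i , j) = Fin.suc i , Fin.suc j

pairs : ∀ n → List (Fin n × Fin n)
pairs zero    = []
pairs (suc n) = map (λ j → Fin.zero , Fin.suc j) (allFin n) ++ map suc² (pairs n)

pairs-oriented : ∀ n → All Oriented (pairs n)
pairs-oriented zero    = []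
pairs-oriented (suc n) =
  All.++⁺ (All.map⁺ (All.tabulate (λ _ → s≤s z≤n))) (All.map⁺ (All.map s≤s (pairs-oriented n)))

pairs-unique : ∀ n → Unique (pairs n)
pairs-unique zero    = []
pairs-unique (suc n) = Unique.++⁺
  (Unique.map⁺ (Fin.suc-injective ∘ cong proj₂) (Unique.allFin⁺ n))
  (Unique.map⁺ suc²-injective (pairs-unique n))
  disjoint
  where
  suc²-injective : ∀ {e e′ : Fin n × Fin n} → suc² e ≡ suc² e′ → e ≡ e′
  suc²-injective refl = refl
  disjoint : ∀ {e} → ¬ (e ∈ map (λ j → Fin.zero , Fin.suc j) (allFin n) × e ∈ map suc² (pairs n))
  disjoint (e∈₁ , e∈₂) with _ , _ , refl ← ∈-map⁻ _ e∈₁ with ∈-map⁻ _ e∈₂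
  ... | _ , _ , ()

-- Doubled to avoid division. A new node 0 contributes `n` pairs, hence `n * 2` to the doubled
-- count.
length-pairs : ∀ n → length (pairs n) * 2 ≡ n * (n ∸ 1)
length-pairs zero    = refl
length-pairs (suc n) = begin
  length (pairs (suc n)) * 2       ≡⟨ cong (_* 2) (length-++ star) ⟩
  (length star + length rest) * 2  ≡⟨ cong (_* 2) (cong₂ _+_ ∣star∣≡n (length-map suc² (pairs n))) ⟩
  (n + length (pairs n)) * 2       ≡⟨ *-distribʳ-+ 2 n (length (pairs n)) ⟩
  n * 2 + length (pairs n) * 2     ≡⟨ cong (n * 2 +_) (length-pairs n) ⟩
  n * 2 + n * (n ∸ 1)              ≡⟨ *-distribˡ-+ n 2 (n ∸ 1) ⟨
  n * (2 + (n ∸ 1))                ≡⟨ step n ⟩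
  suc n * n                        ∎
  where
  open ≡-Reasoning
  star rest : List (Fin (suc n) × Fin (suc n))
  star = map (λ j → Fin.zero , Fin.suc j) (allFin n)
  rest = map suc² (pairs n)
  ∣star∣≡n : length star ≡ n
  ∣star∣≡n = trans (length-map _ (allFin n)) (length-allFin n)
  step : ∀ n → n * (2 + (n ∸ 1)) ≡ suc n * n
  step zero    = refl
  step (suc n) = *-comm (suc n) (2 + n)

-- The double stars

module DoubleStars (t n′ : ℕ) (2m≤n : suc t + suc t ≤ suc n′) where
  m n : ℕ
  m = suc t
  n = suc n′

  hub₁ hub₂ : Fin m → Fin n
  hub₁ c = inject≤ (c ↑ˡ m) 2m≤n
  hub₂ c = inject≤ (m ↑ʳ c) 2m≤n

  toℕ-hub₁ : ∀ c → toℕ (hub₁ c) ≡ toℕ c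
  toℕ-hub₁ c = trans (Fin.toℕ-inject≤ _ 2m≤n) (Fin.toℕ-↑ˡ c m)

  toℕ-hub₂ : ∀ c → toℕ (hub₂ c) ≡ m + toℕ c
  toℕ-hub₂ c = trans (Fin.toℕ-inject≤ _ 2m≤n) (Fin.toℕ-↑ʳ m c)

  hub₁<hub₂ : ∀ c → hub₁ c Fin.< hub₂ c
  hub₁<hub₂ c = subst₂ _<_ (sym (toℕ-hub₁ c)) (sym (toℕ-hub₂ c)) (m<n+m (toℕ c) (s≤s z≤n))

  hub₁≢hub₂ : ∀ c → hub₁ c ≢ hub₂ c
  hub₁≢hub₂ c h≡ = <⇒≢ (hub₁<hub₂ c) (cong toℕ h≡)

  -- An edge u < v of tree c leaves the hub u = m + c, or else u < m and c is the
  -- larger of u and v ∸ m.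
  colorNumber : ℕ → ℕ → ℕ
  colorNumber u v with u <? m
  ... | yes _ = u ⊔ (v ∸ m)
  ... | no  _ = u ∸ m

  -- Outside the trees the number may be m or larger, hence mod.
  edgeColor : Fin n × Fin n → Fin m
  edgeColor (u , v) = colorNumber (toℕ u) (toℕ v) mod m

  edgeColor≡ : ∀ c {u v a b} → toℕ u ≡ a → toℕ v ≡ b → colorNumber a b ≡ toℕ c → edgeColor (u , v) ≡ c
  edgeColor≡ c {u} {v} refl refl eq = Fin.toℕ-injective (begin
    toℕ (edgeColor (u , v))             ≡⟨ Fin.toℕ-fromℕ< _ ⟩
    colorNumber (toℕ u) (toℕ v) % m     ≡⟨ cong (_% m) eq ⟩
    toℕ c % m                           ≡⟨ m<n⇒m%n≡m (Fin.toℕ<n c) ⟩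
    toℕ c                               ∎)
    where open ≡-Reasoning

  colorNumber-low : ∀ {u} v → u < m → colorNumber u v ≡ u ⊔ (v ∸ m)
  colorNumber-low {u} v u<m with u <? m
  ... | yes _   = refl
  ... | no  u≮m = contradiction u<m u≮m

  colorNumber-high : ∀ u v → colorNumber (m + u) v ≡ u
  colorNumber-high u v with m + u <? m
  ... | yes m+u<m = contradiction m+u<m (m+n≮m m u)
  ... | no  _     = m+n∸m≡n m u

  edgeColor-below : ∀ c {w} → w Fin.< hub₁ c → edgeColor (w , hub₂ c) ≡ c
  -- The far end is `m + c`, so the maximum is taken of `w` and `c`, with `w` below `c`.
  edgeColor-below c {w} w<hub₁ = edgeColor≡ c {w} refl (toℕ-hub₂ c) (begin
    colorNumber (toℕ w) (m + toℕ c) ≡⟨ colorNumber-low _ (<-trans w<c (Fin.toℕ<n c)) ⟩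
    toℕ w ⊔ (m + toℕ c ∸ m)         ≡⟨ cong (toℕ w ⊔_) (m+n∸m≡n m (toℕ c)) ⟩
    toℕ w ⊔ toℕ c                   ≡⟨ m≤n⇒m⊔n≡n (<⇒≤ w<c) ⟩
    toℕ c                           ∎)
    where
    open ≡-Reasoning
    w<c : toℕ w < toℕ c
    w<c = subst (toℕ w <_) (toℕ-hub₁ c) w<hub₁

  edgeColor-between : ∀ c {w} → w Fin.≤ hub₂ c → edgeColor (hub₁ c , w) ≡ c
  -- Truncated subtraction covers all `w` up to `m + c` at once: `w ∸ m` is at most `c`, so the
  -- maximum is `c`.
  edgeColor-between c {w} w≤hub₂ = edgeColor≡ c (toℕ-hub₁ c) refl
    (trans (colorNumber-low _ (Fin.toℕ<n c))
      (m≥n⇒m⊔n≡m (m≤n+o⇒m∸n≤o (toℕ w) m (subst (toℕ w ≤_) (toℕ-hub₂ c) w≤hub₂))))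

  edgeColor-above : ∀ c w → edgeColor (hub₂ c , w) ≡ c
  edgeColor-above c w = edgeColor≡ c (toℕ-hub₂ c) refl (colorNumber-high (toℕ c) (toℕ w))

  -- The edge that leads from `w` to a hub in the tree of color `c`. Following spokes from any node
  -- reaches `hub₁ c` in at most two steps. The field `joins` records on which side of the oriented
  -- pair the hub stands.
  record Spoke (c : Fin m) (w : Fin n) : Set where
    field
      edge     : Fin n × Fin n
      oriented : Oriented edge
      colored  : edgeColor edge ≡ c
      hub      : Fin n
      isHub    : hub ≡ hub₁ c ⊎ hub ≡ hub₂ c
      joins    : edge ≡ (w , hub) ⊎ edge ≡ (hub , w)

  spoke : ∀ c w → w ≢ hub₁ c → Spoke c w
  spoke c w w≢ with Fin.<-cmp w (hub₁ c)
  ... | tri≈ _ w≡ _ = contradiction w≡ w≢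
  ... | tri< w< _ _ = record
    { edge = w , hub₂ c ; oriented = <-trans w< (hub₁<hub₂ c) ; colored = edgeColor-below c w<
    ; hub = hub₂ c ; isHub = inj₂ refl ; joins = inj₁ refl }
  ... | tri> _ _ <w with toℕ w ≤? toℕ (hub₂ c)
  -- The case `w ≡ hub₂ c` falls here and gives the edge between the two hubs.
  ...   | yes w≤ = record
    { edge = hub₁ c , w ; oriented = <w ; colored = edgeColor-between c w≤
    ; hub = hub₁ c ; isHub = inj₁ refl ; joins = inj₂ refl }
  ...   | no  w≰ = record
    { edge = hub₂ c , w ; oriented = ≰⇒> w≰ ; colored = edgeColor-above c w
    ; hub = hub₂ c ; isHub = inj₂ refl ; joins = inj₂ refl }

  -- `punchIn` enumerates the `n′` nodes other than the root `hub₁ c`, so each tree is listed with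
  -- `n ∸ 1` edges.
  treeSpoke : ∀ c (w : Fin n′) → Spoke c (punchIn (hub₁ c) w)
  treeSpoke c w = spoke c (punchIn (hub₁ c) w) (Fin.punchInᵢ≢i (hub₁ c) w)

  treeEdge : Fin m → Fin n′ → Fin n × Fin n
  treeEdge c w = Spoke.edge (treeSpoke c w)

  treeEdges : List (Fin n × Fin n)
  treeEdges = cartesianProductWith treeEdge (allFin m) (allFin n′)

  treeEdge∈treeEdges : ∀ c w → treeEdge c w ∈ treeEdges
  treeEdge∈treeEdges c w = ∈-cartesianProductWith⁺ treeEdge (∈-allFin c) (∈-allFin w)

  treeEdges-oriented : All Oriented treeEdges
  treeEdges-oriented = All.cartesianProductWith⁺ (setoid _) (setoid _) treeEdge (allFin m) (allFin n′)
    (λ {c} {w} _ _ → Spoke.oriented (treeSpoke c w))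

  length-treeEdges : length treeEdges ≡ m * n′
  length-treeEdges = trans (length-cartesianProductWith treeEdge (allFin m) (allFin n′))
    (cong₂ _*_ (length-allFin m) (length-allFin n′))

  module _ {es : List (Fin n × Fin n)} (es-oriented : All Oriented es) (es-unique : Unique es)
           (trees⊆ : treeEdges ⊆ es) where

    graph : ColoredEdgeGraph n m
    graph = record
      { edges = es ; oriented = es-oriented ; unique = es-unique
      ; color = edgeColor ∘ proj₁
      -- The witness is the spoke of `hub₂ c`; `punchOut` gives the index of that node among the
      -- nodes other than `hub₁ c`.
      ; color-surjective = λ c → let w = punchOut (hub₁≢hub₂ c) in
          (treeEdge c w , trees⊆ (treeEdge∈treeEdges c w)) ,
          λ { refl → Spoke.colored (treeSpoke c w) }
      }

    module _ (S : Subset m) {c : Fin m} (c∉S : c Subset.∉ S) where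

      _≈_ : Fin n → Fin n → Set
      _≈_ = EqClosure (_∼_ graph S)

      ≈-sym : ∀ {A B} → A ≈ B → B ≈ A
      ≈-sym = EqClosure.symmetric _

      ≈-trans : ∀ {A B D} → A ≈ B → B ≈ D → A ≈ D
      ≈-trans = EqClosure.transitive _

      -- The clause `h ≢ w` matters for `w ≡ hub₂ c`: it forces the hub reached to be `hub₁ c`. The
      -- spoke is taken at a `punchIn` index, where its edge is known to lie in `es`, and then
      -- transported to `w`.
      joined : ∀ w → w ≢ hub₁ c → ∃[ h ] (h ≡ hub₁ c ⊎ h ≡ hub₂ c) × h ≢ w × w ≈ h
      joined w w≢ = subst (λ w → ∃[ h ] (h ≡ hub₁ c ⊎ h ≡ hub₂ c) × h ≢ w × w ≈ h)
        (Fin.punchIn-punchOut (w≢ ∘ sym)) (fromSpoke (punchOut (w≢ ∘ sym)))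
        where
        fromSpoke : ∀ w′ → let w = punchIn (hub₁ c) w′ in
          ∃[ h ] (h ≡ hub₁ c ⊎ h ≡ hub₂ c) × h ≢ w × w ≈ h
        fromSpoke w′ = hub , isHub , h≢w oriented joins , link joins
          where
          open Spoke (treeSpoke c w′)
          h≢w : ∀ {e w} → Oriented e → e ≡ (w , hub) ⊎ e ≡ (hub , w) → hub ≢ w
          h≢w o (inj₁ refl) refl = <-irrefl refl o
          h≢w o (inj₂ refl) refl = <-irrefl refl o
          e : ∃[ e ] e ∈ es
          e = edge , trees⊆ (treeEdge∈treeEdges c w′)
          e∉S : edgeColor edge Subset.∉ S
          e∉S = subst (Subset._∉ S) (sym colored) c∉S
          link : edge ≡ (punchIn (hub₁ c) w′ , hub) ⊎ edge ≡ (hub , punchIn (hub₁ c) w′) →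
                 punchIn (hub₁ c) w′ ≈ hub
          link (inj₁ e≡) = fwd (e , e≡ , e∉S) ◅ ε
          link (inj₂ e≡) = bwd (e , e≡ , e∉S) ◅ ε

      hub₂≈hub₁ : hub₂ c ≈ hub₁ c
      hub₂≈hub₁ with joined (hub₂ c) (hub₁≢hub₂ c ∘ sym)
      ... | _ , inj₁ refl , _   , h₂≈h = h₂≈h
      ... | _ , inj₂ refl , h≢h , _    = contradiction refl h≢h

      ≈hub₁ : ∀ w → w ≈ hub₁ c
      ≈hub₁ w with w Fin.≟ hub₁ c
      ... | yes refl = ε
      ... | no  w≢ with joined w w≢
      ...   | _ , inj₁ refl , _ , w≈h = w≈h
      ...   | _ , inj₂ refl , _ , w≈h = ≈-trans w≈h hub₂≈hub₁

    graph-connected : ColoredEdgeGraph.ColorConnected graph m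
    graph-connected A B _ S ∣S∣+1≡m with c , c∉S ← ∃∉ S (≤-reflexive (trans (+-comm 1 _) ∣S∣+1≡m)) =
      connected⇒path graph S (≈-trans S c∉S (≈hub₁ S c∉S A) (≈-sym S c∉S (≈hub₁ S c∉S B)))

  -- The trees use at most `m * n′` edges and the complete graph has at least `l`, so the trees
  -- extend to exactly `l` edges. Added edges take whatever color `edgeColor` assigns, and the trees
  -- still connect each color class.
  connectedGraph : ∀ {l} → m * n′ ≤ l → l ≤ length (pairs n) →
    Σ[ G ∈ ColoredEdgeGraph n m ] (ColoredEdgeGraph.∣E∣ G ≡ l × ColoredEdgeGraph.ColorConnected G m)
  connectedGraph {l} m*n′≤l l≤∣pairs∣
    with zs , zs-oriented , zs-unique , trees⊆zs , ∣zs∣≡l ←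
      extend-unique (Product.≡-dec Fin._≟_ Fin._≟_) treeEdges treeEdges-oriented
        (pairs-oriented n) (pairs-unique n) (subst (_≤ l) (sym length-treeEdges) m*n′≤l) l≤∣pairs∣
    = graph zs-oriented zs-unique trees⊆zs , ∣zs∣≡l , graph-connected zs-oriented zs-unique trees⊆zs

theorem5p1 : ∀ (n l m t : ℕ) → 1 ≤ n → 1 ≤ l → 1 ≤ m → 1 ≤ t →
    m ≡ t + 1 → m ≤ l → l ≤ (n * (n ∸ 1)) / 2 →
    (μ : ℕ) → Isμ l m t μ → μ ≥ n ∸ 1 →
    2 * l ≥ (t + 1) * n →
    Σ[ G ∈ ColoredEdgeGraph n m ]
    (ColoredEdgeGraph.∣E∣ G ≡ l × ColoredEdgeGraph.ColorConnected G (t + 1))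
theorem5p1 zero            l _ t ()
-- One node would force `l` to be 0. Hence `n′` is positive below, as the cancellation of `n′`
-- requires.
theorem5p1 (suc zero)      l _ t _ 1≤l _ _ _ _ l≤ = contradiction (≤-trans 1≤l l≤) λ ()
theorem5p1 n@(suc n′@(suc _)) l _ t _ _ _ _ refl _ l≤ μ ((𝓕 , part , isμ) , _) n-1≤μ _
  rewrite +-comm t 1 = DoubleStars.connectedGraph t n′ 2m≤n m*n′≤l l≤∣pairs∣
  where
  open ≤-Reasoning
  l*2≤n*n′ : l * 2 ≤ n * n′
  l*2≤n*n′ = ≤-trans (*-monoˡ-≤ 2 l≤) (m/n*n≤m (n * n′) 2)
  m*n′≤l : suc t * n′ ≤ l
  m*n′≤l = partitionμ⇒m*k≤l part isμ n-1≤μ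
  2m≤n : suc t + suc t ≤ n
  -- The lower bound on `l` is doubled and compared with twice the upper bound, then `n′` is
  -- cancelled. This makes room for two hubs per color.
  2m≤n = *-cancelʳ-≤ (suc t + suc t) n n′ (begin
    (suc t + suc t) * n′      ≡⟨ *-distribʳ-+ n′ (suc t) (suc t) ⟩
    suc t * n′ + suc t * n′   ≤⟨ +-mono-≤ m*n′≤l m*n′≤l ⟩
    l + l                     ≡⟨ cong (l +_) (+-identityʳ l) ⟨
    2 * l                     ≡⟨ *-comm 2 l ⟩
    l * 2                     ≤⟨ l*2≤n*n′ ⟩
    n * n′                    ∎)
  l≤∣pairs∣ : l ≤ length (pairs n)
  l≤∣pairs∣ = *-cancelʳ-≤ l (length (pairs n)) 2 (subst (l * 2 ≤_) (sym (length-pairs n)) l*2≤n*n′)
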